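{- $[\mathbf{Txt}\mathbf{It}\mathbf{Bc}_C]_{\mathbf{REC}} = [\mathbf{Txt}\mathbf{G}\mathbf{Bc}_C]_{\mathbf{REC}}$.
   Context: Fix an acceptable numbering $(\varphi_e)_{e\in\mathbb{N}}$ of all partial computable functions. A number $e$ is a $C$-index if $\varphi_e$ is total with values in $\{0,1\}$; then $C_e=\{x:\varphi_e(x)=1\}$. $\mathbf{REC}$ is the collection of recursive subsets of $\mathbb{N}$; $\mathcal{P}$ denotes the partial computable functions. Fix a pause symbol $\#$. A text is a total function $T:\mathbb{N}\to\mathbb{N}\cup\{\#\}$, $\mathrm{content}(T)=\mathrm{range}(T)\setminus\{\#\}$, $T$ is a text for $L$ if $\mathrm{content}(T)=L$, $T[n]=(T(0),\dots,T(n-1))$. A learner is some $h\in\mathcal{P}$. Hypothesis sequences: $\mathbf{G}(h,T)(i)=h(T[i])$; iterative $\mathbf{It}(h,T)(0)=h(\varepsilon)$ and $\mathbf{It}(h,T)(i)=h(\mathbf{It}(h,T)(i-1),T(i-1))$ for $i>0$. Restriction $\mathbf{Bc}_C$ on hypothesis sequence $p$ and text $T$: there is $n_0$ such that for all $n\ge n_0$, $p(n)$ is a $C$-index with $C_{p(n)}=\mathrm{content}(T)$. A learner $h$ $\mathbf{Txt}\beta\mathbf{Bc}_C$-learns $L$ iff $\mathbf{Bc}_C(\beta(h,T),T)$ holds for every text $T$ for $L$; $[\mathbf{Txt}\beta\mathbf{Bc}_C]_{\mathbf{REC}}$ is the set of all classes $\mathcal{L}\subseteq\mathbf{REC}$ for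 which some $h\in\mathcal{P}$ learns every $L\in\mathcal{L}$. -}

module Defs where

open import Level using (0ℓ)
open import Data.Nat using (ℕ; zero; suc; _+_; _*_; _≤_; _≡ᵇ_; ⌊_/2⌋)
open import Data.Product using (_×_; _,_; ∃; ∃-syntax; Σ)
open import Data.Sum using (_⊎_)
open import Data.Maybe using (Maybe; just; nothing; _>>=_)
open import Data.List using (List; []; _∷_)
open import Data.Bool using (if_then_else_)
open import Relation.Binary.PropositionalEquality using (_≡_)
open import Function.Bundles using (_⇔_)

pair : ℕ → ℕ → ℕ
pair a b = ⌊ (a + b) * suc (a + b) /2⌋ + b

-- unpair enumerates the diagonals: (0,0),(1,0),(0,1),(2,0),(1,1),(0,2),...
unpair : ℕ → ℕ × ℕ
unpair zero = 0 , 0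
unpair (suc z) with unpair z
... | zero  , b = suc b , 0
... | suc a , b = a , suc b

-- A concrete acceptable numbering (φ_e) of the unary partial computable
-- functions: e is decoded as ⟨tag, rest⟩ and interpreted in a
-- Kleene-style basis (zero, successor, projections of the pairing,
-- composition, pairing, primitive recursion, μ-operator).
-- eval k e x is the computation with fuel k; it is monotone in k.

mutual
  eval : ℕ → ℕ → ℕ → Maybe ℕ
  eval zero    e x = nothing
  eval (suc k) e x with unpair e
  ... | 0 , _ = just 0
  ... | 1 , _ = just (suc x)
  ... | 2 , _ = just (Data.Product.proj₁ (unpair x))
  ... | 3 , _ = just (Data.Product.proj₂ (unpair x))
  ... | 4 , r with unpair r
  ...   | f , g = eval k g x >>= eval k f
  eval (suc k) e x | 5 , r with unpair r
  ...   | f , g = eval k f x >>= λ u → eval k g x >>= λ v → just (pair u v)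
  eval (suc k) e x | 6 , r with unpair r | unpair x
  ...   | f , g | a , n = primrec k f g a n
  eval (suc k) e x | 7 , f = search k k f x 0
  eval (suc k) e x | suc (suc (suc (suc (suc (suc (suc (suc _))))))) , _ = just 0

  primrec : ℕ → ℕ → ℕ → ℕ → ℕ → Maybe ℕ
  primrec k f g a zero    = eval k f a
  primrec k f g a (suc n) = primrec k f g a n >>= λ r → eval k g (pair a (pair n r))

  search : ℕ → ℕ → ℕ → ℕ → ℕ → Maybe ℕ
  search k zero    f x n = nothing
  search k (suc j) f x n =
    eval k f (pair x n) >>= λ v → if v ≡ᵇ 0 then just n else search k j f x (suc n)

_·_↓_ : ℕ → ℕ → ℕ → Set
e · x ↓ y = ∃[ k ] eval k e x ≡ just y

Lang : Set₁
Lang = ℕ → Set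

IsCIndex : ℕ → Set
IsCIndex e = ∀ x → ∃[ y ] ((e · x ↓ y) × (y ≡ 0 ⊎ y ≡ 1))

C : ℕ → Lang
C e x = e · x ↓ 1

Recursive : Lang → Set
Recursive L = ∃[ e ] (IsCIndex e × (∀ x → L x ⇔ C e x))

-- Texts (nothing plays the role of the pause symbol #)

Text : Set
Text = ℕ → Maybe ℕ

content : Text → Lang
content T x = ∃[ n ] T n ≡ just x

TextFor : Text → Lang → Set
TextFor T L = ∀ x → content T x ⇔ L x

prefix : Text → ℕ → List (Maybe ℕ)
prefix T zero    = []
prefix T (suc n) = prefix T n Data.List.∷ʳ T n

codeSym : Maybe ℕ → ℕ
codeSym nothing  = 0
codeSym (just x) = suc x

codeSeq : List (Maybe ℕ) → ℕ
codeSeq []      = 0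
codeSeq (s ∷ σ) = suc (pair (codeSym s) (codeSeq σ))

-- iterative learner inputs: ε and (hypothesis, datum)
codeItStart : ℕ
codeItStart = 0

codeItStep : ℕ → Maybe ℕ → ℕ
codeItStep p s = suc (pair p (codeSym s))

-- Hypothesis sequences, as (partial) graphs: Seq h T i p means the
-- i-th hypothesis of learner h on text T is defined and equals p.

HypSeq : Set₁
HypSeq = ℕ → ℕ → Set

G : ℕ → Text → HypSeq
G h T i p = h · codeSeq (prefix T i) ↓ p

data It (h : ℕ) (T : Text) : HypSeq where
  it-zero : ∀ {p} → h · codeItStart ↓ p → It h T 0 p
  it-suc  : ∀ {i p q} → It h T i p → h · codeItStep p (T i) ↓ q → It h T (suc i) q

BcC : HypSeq → Text → Set
BcC P T = ∃[ n₀ ] (∀ n → n₀ ≤ n →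
            ∃[ e ] (P n e × IsCIndex e × (∀ x → C e x ⇔ content T x)))

Interaction : Set₁
Interaction = ℕ → Text → HypSeq

Learns : Interaction → ℕ → Lang → Set
Learns β h L = ∀ T → TextFor T L → BcC (β h T) T

LearnableREC : Interaction → (Lang → Set) → Set₁
LearnableREC β ℒ = (∀ L → ℒ L → Recursive L) × ∃[ h ] (∀ L → ℒ L → Learns β h L)

{-# OPTIONS --safe #-}
module Submission where

open import Defs
open import Data.Nat
open import Data.Nat.Properties
open import Data.Nat.Induction using (<-rec)
open import Data.Nat.Tactic.RingSolver using (solve-∀)
open import Data.Product using (_×_; _,_; ∃-syntax; proj₁; proj₂; map₂)
open import Data.Maybe using (Maybe; just; nothing; _>>=_)
open import Data.Maybe.Properties using (just-injective)
open import Data.List using (List; []; _∷_; _∷ʳ_; _++_; map; foldl; length; reverse)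
open import Data.List.Properties using (reverse-++; reverse-involutive; ++-assoc; length-++)
open import Function using (_∘_; flip)
open import Function.Bundles using (_⇔_; mk⇔)
open import Function.Construct.Composition using (_⇔-∘_)
open import Relation.Binary.PropositionalEquality

-- An iterative learner has the power of a full-information learner h because a
-- hypothesis can be padded with the whole history of the text, and Bc_C only
-- constrains the function computed by the hypothesis.  As h may diverge on early
-- prefixes, at time n the hypothesis is h(τ), where τ is the longest prefix seen
-- on which h halts within a step bound growing with n: eventually τ is past the
-- point of convergence.  For the fixed h, step-bounded evaluation is a total
-- computable function by induction on the index h, so no universal function is
-- needed.  Conversely, a full-information learner unrolls the iteration.

-- The pairing function

triangle : ℕ → ℕ
triangle s = ⌊ s * suc s /2⌋

⌊n+2*m/2⌋ : ∀ n m → ⌊ n + 2 * m /2⌋ ≡ ⌊ n /2⌋ + m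
⌊n+2*m/2⌋ n zero = trans (cong ⌊_/2⌋ (+-identityʳ n)) (sym (+-identityʳ _))
⌊n+2*m/2⌋ n (suc m) = begin
  ⌊ n + 2 * suc m /2⌋       ≡⟨ cong ⌊_/2⌋ (shift n m) ⟩
  suc ⌊ n + 2 * m /2⌋       ≡⟨ cong suc (⌊n+2*m/2⌋ n m) ⟩
  suc (⌊ n /2⌋ + m)         ≡⟨ +-suc _ m ⟨
  ⌊ n /2⌋ + suc m           ∎
  where
  open ≡-Reasoning
  shift : ∀ n m → n + 2 * suc m ≡ 2 + (n + 2 * m)
  shift = solve-∀

triangle-suc : ∀ s → triangle (suc s) ≡ triangle s + suc s
triangle-suc s = trans (cong ⌊_/2⌋ (expand s)) (⌊n+2*m/2⌋ (s * suc s) (suc s))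
  where
  expand : ∀ s → suc s * suc (suc s) ≡ s * suc s + 2 * suc s
  expand = solve-∀

-- With `pair-wrap`, this shows that `pair` obeys the recursion defining `unpair`, which makes the
-- two mutually inverse.
pair-next : ∀ a b → pair a (suc b) ≡ suc (pair (suc a) b)
pair-next a b = trans (+-suc _ b) (cong (λ s → suc (triangle s + b)) (+-suc a b))

pair-wrap : ∀ a → pair (suc a) 0 ≡ suc (pair 0 a)
pair-wrap a = begin
  triangle (suc (a + 0)) + 0  ≡⟨ +-identityʳ _ ⟩
  triangle (suc (a + 0))      ≡⟨ cong (triangle ∘ suc) (+-identityʳ a) ⟩
  triangle (suc a)            ≡⟨ triangle-suc a ⟩
  triangle a + suc a          ≡⟨ +-suc _ a ⟩
  suc (triangle a + a)        ∎
  where open ≡-Reasoning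

unpair-next : ∀ z {a b} → unpair z ≡ (suc a , b) → unpair (suc z) ≡ (a , suc b)
unpair-next z eq rewrite eq = refl

unpair-wrap : ∀ z {b} → unpair z ≡ (0 , b) → unpair (suc z) ≡ (suc b , 0)
unpair-wrap z eq rewrite eq = refl

unpair-pair : ∀ a b → unpair (pair a b) ≡ (a , b)
unpair-pair a b = diagonal (a + b) a b refl
  where
  -- Induction along the enumeration: a step back within a diagonal lowers `b`, a wrap to the
  -- previous diagonal lowers `s`.
  diagonal : ∀ s a b → a + b ≡ s → unpair (pair a b) ≡ (a , b)
  diagonal s zero zero eq = refl
  diagonal (suc s) (suc a) zero eq = trans (cong unpair (pair-wrap a))
    (unpair-wrap (pair 0 a) (diagonal s 0 a (trans (sym (+-identityʳ a)) (suc-injective eq))))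
  diagonal s a (suc b) eq = trans (cong unpair (pair-next a b))
    (unpair-next (pair (suc a) b) (diagonal s (suc a) b (trans (sym (+-suc a b)) eq)))

pair-unpair : ∀ z → pair (proj₁ (unpair z)) (proj₂ (unpair z)) ≡ z
pair-unpair zero = refl
pair-unpair (suc z) with unpair z | pair-unpair z
... | zero  , b | eq = trans (pair-wrap b) (cong suc eq)
... | suc a , b | eq = trans (pair-next a b) (cong suc eq)

n≤triangle : ∀ s → s ≤ triangle s
n≤triangle zero = z≤n
n≤triangle (suc s) rewrite triangle-suc s = m≤n+m (suc s) (triangle s)

a+b≤pair-a-b : ∀ a b → a + b ≤ pair a b
a+b≤pair-a-b a b = ≤-trans (n≤triangle (a + b)) (m≤m+n _ b)

b≤pair-a-b : ∀ a b → b ≤ pair a b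
b≤pair-a-b a b = m≤n+m b _

unpair-sum : ∀ z {a b} → unpair z ≡ (a , b) → a + b ≤ z
unpair-sum z {a} {b} eq = ≤-trans (a+b≤pair-a-b a b)
  (≤-reflexive (trans (cong (λ p → pair (proj₁ p) (proj₂ p)) (sym eq)) (pair-unpair z)))

π₁ π₂ : ℕ → ℕ
π₁ z = proj₁ (unpair z)
π₂ z = proj₂ (unpair z)

π₁≤ : ∀ z → π₁ z ≤ z
π₁≤ z = ≤-trans (m≤m+n (π₁ z) (π₂ z)) (unpair-sum z refl)

π₂≤ : ∀ z → π₂ z ≤ z
π₂≤ z = ≤-trans (m≤n+m (π₂ z) (π₁ z)) (unpair-sum z refl)

-- A positive tag accounts for the strict descent that induction on indices needs.
unpair-< : ∀ z {t r} → unpair z ≡ (suc t , r) → r < z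
unpair-< z {t} {r} eq = ≤-trans (s≤s (m≤n+m r t)) (unpair-sum z eq)

π₁-pair : ∀ a b → π₁ (pair a b) ≡ a
π₁-pair a b = cong proj₁ (unpair-pair a b)

π₂-pair : ∀ a b → π₂ (pair a b) ≡ b
π₂-pair a b = cong proj₂ (unpair-pair a b)

-- Evaluation

>>=-just : ∀ (m : Maybe ℕ) {f : ℕ → Maybe ℕ} {y} → (m >>= f) ≡ just y →
           ∃[ u ] (m ≡ just u × f u ≡ just y)
>>=-just (just u) eq = u , refl , eq

just->>= : ∀ {m : Maybe ℕ} {f : ℕ → Maybe ℕ} {u y} → m ≡ just u → f u ≡ just y →
           (m >>= f) ≡ just y
just->>= refl eq = eq

mutual
  eval-suc : ∀ k e x {y} → eval k e x ≡ just y → eval (suc k) e x ≡ just y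
  eval-suc (suc k) e x eq with unpair e
  ... | 0 , _ = eq
  ... | 1 , _ = eq
  ... | 2 , _ = eq
  ... | 3 , _ = eq
  ... | 4 , r with unpair r
  ...   | f , g with >>=-just (eval k g x) eq
  ...     | u , p , q = just->>= (eval-suc k g x p) (eval-suc k f u q)
  eval-suc (suc k) e x eq | 5 , r with unpair r
  ...   | f , g with >>=-just (eval k f x) eq
  ...     | u , p , q with >>=-just (eval k g x) q
  ...       | v , p′ , q′ =
    just->>= (eval-suc k f x p) (just->>= (eval-suc k g x p′) q′)
  eval-suc (suc k) e x eq | 6 , r with unpair r | unpair x
  ...   | f , g | a , n = primrec-suc k f g a n eq
  eval-suc (suc k) e x eq | 7 , f = search-suc k k f x 0 eq
  eval-suc (suc k) e x eq | suc (suc (suc (suc (suc (suc (suc (suc _))))))) , _ = eq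

  primrec-suc : ∀ k f g a n {y} → primrec k f g a n ≡ just y → primrec (suc k) f g a n ≡ just y
  primrec-suc k f g a zero eq = eval-suc k f a eq
  primrec-suc k f g a (suc n) eq with >>=-just (primrec k f g a n) eq
  ... | u , p , q = just->>= (primrec-suc k f g a n p) (eval-suc k g _ q)

  -- In `eval` the fuel also limits the number of arguments tested, so both bounds rise together.
  search-suc : ∀ k j f x n {y} → search k j f x n ≡ just y →
               search (suc k) (suc j) f x n ≡ just y
  search-suc k (suc j) f x n eq with >>=-just (eval k f (pair x n)) eq
  ... | zero  , p , q = just->>= (eval-suc k f _ p) q
  ... | suc v , p , q = just->>= (eval-suc k f _ p) (search-suc k j f x (suc n) q)

eval-mono : ∀ {k l e x y} → k ≤ l → eval k e x ≡ just y → eval l e x ≡ just y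
eval-mono {k} {l} {e} {x} {y} k≤l eq = go (≤⇒≤′ k≤l)
  where
  go : ∀ {l} → k ≤′ l → eval l e x ≡ just y
  go ≤′-refl = eq
  go (≤′-step {n} p) = eval-suc n e x (go p)

primrec-mono : ∀ {k l f g a n y} → k ≤ l → primrec k f g a n ≡ just y → primrec l f g a n ≡ just y
primrec-mono {k} {l} {f} {g} {a} {n} {y} k≤l eq = go (≤⇒≤′ k≤l)
  where
  go : ∀ {l} → k ≤′ l → primrec l f g a n ≡ just y
  go ≤′-refl = eq
  go (≤′-step {m} p) = primrec-suc m f g a n (go p)

↓-functional : ∀ {e x y z} → e · x ↓ y → e · x ↓ z → y ≡ z
↓-functional {e} {x} (k , p) (l , q) = just-injective
  (trans (sym (eval-mono {l = k ⊔ l} {e} {x} (m≤m⊔n k l) p))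
         (eval-mono {l = k ⊔ l} {e} {x} (m≤n⊔m k l) q))

-- Nested pairings are huge numbers; kept opaque, they are handled through their decoding equations
-- and never computed.
opaque
  comp pairing recursor : ℕ → ℕ → ℕ
  comp     f g = pair 4 (pair f g)
  pairing  f g = pair 5 (pair f g)
  recursor f g = pair 6 (pair f g)

  comp-pair : ∀ f g → pair 4 (pair f g) ≡ comp f g
  comp-pair f g = refl

  pairing-pair : ∀ f g → pair 5 (pair f g) ≡ pairing f g
  pairing-pair f g = refl

  unpair-comp : ∀ f g → unpair (comp f g) ≡ (4 , pair f g)
  unpair-comp f g = unpair-pair 4 (pair f g)

  unpair-pairing : ∀ f g → unpair (pairing f g) ≡ (5 , pair f g)
  unpair-pairing f g = unpair-pair 5 (pair f g)

  unpair-recursor : ∀ f g → unpair (recursor f g) ≡ (6 , pair f g)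
  unpair-recursor f g = unpair-pair 6 (pair f g)

-- Stated for any `e` that decodes suitably, so that it serves for `comp f g` and for the arbitrary
-- indices met in `boundedᶜ`.
eval-comp : ∀ k e x {r f g} → unpair e ≡ (4 , r) → unpair r ≡ (f , g) →
            eval (suc k) e x ≡ (eval k g x >>= eval k f)
eval-comp k e x p q rewrite p | q = refl

eval-pairing : ∀ k e x {r f g} → unpair e ≡ (5 , r) → unpair r ≡ (f , g) →
               eval (suc k) e x ≡ (eval k f x >>= λ u → eval k g x >>= λ v → just (pair u v))
eval-pairing k e x p q rewrite p | q = refl

eval-recursor : ∀ k e x {r f g} → unpair e ≡ (6 , r) → unpair r ≡ (f , g) →
                eval (suc k) e x ≡ primrec k f g (proj₁ (unpair x)) (proj₂ (unpair x))
eval-recursor k e x p q rewrite p | q = refl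

↓-comp : ∀ {f g x u y} → g · x ↓ u → f · u ↓ y → comp f g · x ↓ y
↓-comp {f} {g} {x} {u} (k , p) (l , q) = suc (k ⊔ l) ,
  trans (eval-comp (k ⊔ l) (comp f g) x (unpair-comp f g) (unpair-pair f g))
        (just->>= (eval-mono {e = g} {x} (m≤m⊔n k l) p) (eval-mono {e = f} {u} (m≤n⊔m k l) q))

↓-pairing : ∀ {f g x u v} → f · x ↓ u → g · x ↓ v → pairing f g · x ↓ pair u v
↓-pairing {f} {g} {x} {u} {v} (k , p) (l , q) = suc (k ⊔ l) ,
  trans (eval-pairing (k ⊔ l) (pairing f g) x (unpair-pairing f g) (unpair-pair f g))
        (just->>= {u = u} (eval-mono {e = f} {x} (m≤m⊔n k l) p)
                  (just->>= {u = v} (eval-mono {e = g} {x} (m≤n⊔m k l) q) refl))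

eval-recursor-pair : ∀ k f g a n → eval (suc k) (recursor f g) (pair a n) ≡ primrec k f g a n
eval-recursor-pair k f g a n = trans
  (eval-recursor k (recursor f g) (pair a n) (unpair-recursor f g) (unpair-pair f g))
  (cong (λ z → primrec k f g (proj₁ z) (proj₂ z)) (unpair-pair a n))

↓-recursor-zero : ∀ {f g a y} → f · a ↓ y → recursor f g · pair a 0 ↓ y
↓-recursor-zero {f} {g} {a} (k , p) = suc k , trans (eval-recursor-pair k f g a 0) p

↓-recursor-suc : ∀ {f g a n r y} → recursor f g · pair a n ↓ r → g · pair a (pair n r) ↓ y →
                 recursor f g · pair a (suc n) ↓ y
-- Convergence forces positive fuel; one unit decodes the index, the rest is the fuel of the loop.
↓-recursor-suc {f} {g} {a} {n} {r} (suc k , p) (l , q) = suc (k ⊔ l) ,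
  trans (eval-recursor-pair (k ⊔ l) f g a (suc n))
        (just->>= {u = r}
          (primrec-mono {f = f} {g} {a} {n} (m≤m⊔n k l) (trans (sym (eval-recursor-pair k f g a n)) p))
          (eval-mono {e = g} {pair a (pair n r)} (m≤n⊔m k l) q))

-- Total computable functions

record Computable (f : ℕ → ℕ) : Set where
  field
    index    : ℕ
    computes : ∀ x → index · x ↓ f x
open Computable

-- A record rather than an abbreviation, so that `f` can be inferred and not just its composite with
-- the projections.
record Computable₂ (f : ℕ → ℕ → ℕ) : Set where
  constructor curried
  field uncurried : Computable (λ z → f (π₁ z) (π₂ z))
open Computable₂

record Computable₃ (f : ℕ → ℕ → ℕ → ℕ) : Set where
  constructor curried₃
  field uncurried₃ : Computable (λ z → f (π₁ z) (π₁ (π₂ z)) (π₂ (π₂ z)))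
open Computable₃

computable-cong : ∀ {f g} → (∀ x → f x ≡ g x) → Computable f → Computable g
computable-cong eq F .index = F .index
computable-cong eq F .computes x = subst (F .index · x ↓_) (eq x) (F .computes x)

_∘ᶜ_ : ∀ {f g} → Computable f → Computable g → Computable (λ x → f (g x))
(F ∘ᶜ G) .index = comp (F .index) (G .index)
(F ∘ᶜ G) .computes x = ↓-comp (G .computes x) (F .computes _)

pairᶜ : ∀ {f g} → Computable f → Computable g → Computable (λ x → pair (f x) (g x))
pairᶜ F G .index = pairing (F .index) (G .index)
pairᶜ F G .computes x = ↓-pairing (F .computes x) (G .computes x)

sucᶜ : Computable suc
sucᶜ .index = pair 1 0
sucᶜ .computes x = 1 , refl

π₁ᶜ : Computable π₁
π₁ᶜ .index = pair 2 0
π₁ᶜ .computes x = 1 , refl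

π₂ᶜ : Computable π₂
π₂ᶜ .index = pair 3 0
π₂ᶜ .computes x = 1 , refl

constᶜ : ∀ c → Computable (λ _ → c)
constᶜ zero .index = 0
constᶜ zero .computes x = 1 , refl
constᶜ (suc c) = sucᶜ ∘ᶜ constᶜ c

idᶜ : Computable (λ x → x)
idᶜ = computable-cong pair-unpair (pairᶜ π₁ᶜ π₂ᶜ)

apply₂ : ∀ {f u v} → Computable₂ f → Computable u → Computable v → Computable (λ x → f (u x) (v x))
apply₂ {f} {u} {v} F U V = computable-cong
  (λ x → cong₂ f (π₁-pair (u x) (v x)) (π₂-pair (u x) (v x)))
  (uncurried F ∘ᶜ pairᶜ U V)

natrec : ℕ → (ℕ → ℕ → ℕ) → ℕ → ℕ
natrec z s zero    = z
natrec z s (suc n) = s n (natrec z s n)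

natrecᶜ : ∀ {z s n} → Computable z → Computable₃ s → Computable n →
          Computable (λ x → natrec (z x) (s x) (n x))
natrecᶜ {z} {s} {n} Z S N = recᶜ
  where
  f g : ℕ
  f = Z .index
  g = uncurried₃ S .index

  step : ∀ a i r → g · pair a (pair i r) ↓ s a i r
  step a i r = subst (g · pair a (pair i r) ↓_) eq (uncurried₃ S .computes _)
    where
    eq : s (π₁ (pair a (pair i r))) (π₁ (π₂ (pair a (pair i r)))) (π₂ (π₂ (pair a (pair i r)))) ≡ s a i r
    eq rewrite unpair-pair a (pair i r) | unpair-pair i r = refl

  loop : ∀ a m → recursor f g · pair a m ↓ natrec (z a) (s a) m
  loop a zero    = ↓-recursor-zero {f} {g} {a} (Z .computes a)
  loop a (suc m) = ↓-recursor-suc {f} {g} {a} {m} (loop a m) (step a m _)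

  recᶜ : Computable (λ x → natrec (z x) (s x) (n x))
  recᶜ .index = comp (recursor f g) (pairing (idᶜ .index) (N .index))
  recᶜ .computes x = ↓-comp (↓-pairing (idᶜ .computes x) (N .computes x)) (loop x (n x))

caseℕ : ℕ → (ℕ → ℕ) → ℕ → ℕ
caseℕ z s zero    = z
caseℕ z s (suc n) = s n

caseᶜ : ∀ {z s n} → Computable z → Computable₂ s → Computable n →
        Computable (λ x → caseℕ (z x) (s x) (n x))
caseᶜ {z} {s} {n} Z S N = computable-cong (λ x → agree x (n x))
  (natrecᶜ {s = λ x i _ → s x i} Z (curried₃ (apply₂ S π₁ᶜ (π₁ᶜ ∘ᶜ π₂ᶜ))) N)
  where
  agree : ∀ x m → natrec (z x) (λ i _ → s x i) m ≡ caseℕ (z x) (s x) m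
  agree x zero    = refl
  agree x (suc m) = refl

predᶜ : Computable pred
predᶜ = computable-cong (λ { zero → refl ; (suc _) → refl })
  (caseᶜ {s = λ _ m → m} (constᶜ 0) (curried π₂ᶜ) idᶜ)

-- Bounded search for the first nonzero value

orElse : ℕ → ℕ → ℕ
orElse r w = caseℕ w suc r

-- The first nonzero value of `v` below the bound, or 0 if there is none; once found, `orElse` keeps
-- it.
scan : (ℕ → ℕ) → ℕ → ℕ
scan v = natrec 0 (λ i r → orElse r (v i))

scanᶜ : ∀ {v n} → Computable₂ v → Computable n → Computable (λ x → scan (v x) (n x))
scanᶜ V N = natrecᶜ (constᶜ 0)
  (curried₃ (caseᶜ (apply₂ V π₁ᶜ (π₁ᶜ ∘ᶜ π₂ᶜ)) (curried (sucᶜ ∘ᶜ π₂ᶜ)) (π₂ᶜ ∘ᶜ π₂ᶜ))) N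

scan-stable : ∀ v {i y} j → scan v i ≡ suc y → scan v (j + i) ≡ suc y
scan-stable v zero    eq = eq
scan-stable v {i} (suc j) eq = cong (λ r → orElse r (v (j + i))) (scan-stable v {i} j eq)

scan-sound : ∀ v i {y} → scan v i ≡ suc y → ∃[ t ] (t < i × v t ≡ suc y)
scan-sound v (suc i) eq with scan v i in p
... | zero  = i , ≤-refl , eq
... | suc w with scan-sound v i p
...   | t , t<i , q = t , m≤n⇒m≤1+n t<i , trans q eq

-- By stage `suc t` something is found, `v t` at the latest; soundness locates it and stability
-- carries it to `n`. The bound `s ≤ t` later makes the chosen prefix long enough.
scan-complete : ∀ v {t n y} → t < n → v t ≡ suc y → ∃[ s ] ∃[ w ] (s ≤ t × v s ≡ suc w × scan v n ≡ suc w)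
scan-complete v {t} {n} t<n eq with hit (scan v t) refl
  where
  hit : ∀ r → scan v t ≡ r → ∃[ w ] scan v (suc t) ≡ suc w
  hit zero    p = _ , trans (cong (λ r → orElse r (v t)) p) eq
  hit (suc r) p = _ , cong (λ r → orElse r (v t)) p
... | w , p with scan-sound v (suc t) p
...   | s , s≤t , q = s , w , ≤-pred s≤t , q ,
  trans (cong (scan v) (sym (m∸n+n≡m t<n))) (scan-stable v {suc t} (n ∸ suc t) p)

-- Step-bounded evaluation

BoundedEval : ℕ → Set
BoundedEval e = Computable₂ (λ x k → codeSym (eval k e x))

bindᶜ : ∀ (m : ℕ → Maybe ℕ) (f : ℕ → ℕ → Maybe ℕ) →
        Computable (λ x → codeSym (m x)) → Computable₂ (λ x u → codeSym (f x u)) →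
        Computable (λ x → codeSym (m x >>= f x))
bindᶜ m f M F = computable-cong agree (caseᶜ {s = λ x u → codeSym (f x u)} (constᶜ 0) F M)
  where
  agree : ∀ x → caseℕ 0 (λ u → codeSym (f x u)) (codeSym (m x)) ≡ codeSym (m x >>= f x)
  agree x with m x
  ... | nothing = refl
  ... | just u  = refl

bounded-step : ∀ {e} (body : ℕ → ℕ → Maybe ℕ) → (∀ k x → eval (suc k) e x ≡ body k x) →
               Computable₂ (λ x k → codeSym (body k x)) → BoundedEval e
bounded-step {e} body unfold B = curried (computable-cong (λ z → agree (π₁ z) (π₂ z))
  (caseᶜ {s = λ z k → codeSym (body k (π₁ z))} (constᶜ 0)
    (curried (apply₂ B (π₁ᶜ ∘ᶜ π₁ᶜ) π₂ᶜ)) π₂ᶜ))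
  where
  agree : ∀ x k → caseℕ 0 (λ k → codeSym (body k x)) k ≡ codeSym (eval k e x)
  agree x zero    = refl
  agree x (suc k) = cong codeSym (sym (unfold k x))

bounded-comp : ∀ {f g} → BoundedEval f → BoundedEval g →
               Computable₂ (λ x k → codeSym (eval k g x >>= eval k f))
bounded-comp {f} {g} F G = curried (bindᶜ (λ z → eval (π₂ z) g (π₁ z)) (λ z → eval (π₂ z) f)
  (uncurried G) (curried (apply₂ F π₂ᶜ (π₂ᶜ ∘ᶜ π₁ᶜ))))

bounded-pairing : ∀ {f g} → BoundedEval f → BoundedEval g →
  Computable₂ (λ x k → codeSym (eval k f x >>= λ u → eval k g x >>= λ v → just (pair u v)))
bounded-pairing {f} {g} F G = curried (bindᶜ (λ z → eval (π₂ z) f (π₁ z))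
  (λ z u → eval (π₂ z) g (π₁ z) >>= λ v → just (pair u v))
  (uncurried F)
  (curried (bindᶜ (λ w → eval (π₂ (π₁ w)) g (π₁ (π₁ w))) (λ w v → just (pair (π₂ w) v))
    (apply₂ G (π₁ᶜ ∘ᶜ π₁ᶜ) (π₂ᶜ ∘ᶜ π₁ᶜ))
    (curried (sucᶜ ∘ᶜ pairᶜ (π₂ᶜ ∘ᶜ π₁ᶜ) π₂ᶜ)))))

bounded-primrec : ∀ {f g} → BoundedEval f → BoundedEval g →
                  Computable₂ (λ x k → codeSym (primrec k f g (π₁ x) (π₂ x)))
bounded-primrec {f} {g} F G = curried (computable-cong (λ z → agree (π₂ z) (π₁ (π₁ z)) (π₂ (π₁ z)))
  (natrecᶜ {s = λ z → step (π₂ z) (π₁ (π₁ z))} (apply₂ F (π₁ᶜ ∘ᶜ π₁ᶜ) π₂ᶜ)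
    (curried₃ (caseᶜ {s = λ w v → codeSym (eval (π₂ (π₁ w)) g (pair (π₁ (π₁ (π₁ w))) (pair (π₁ (π₂ w)) v)))}
      (constᶜ 0)
      (curried (apply₂ G
        (pairᶜ (π₁ᶜ ∘ᶜ (π₁ᶜ ∘ᶜ (π₁ᶜ ∘ᶜ π₁ᶜ))) (pairᶜ (π₁ᶜ ∘ᶜ (π₂ᶜ ∘ᶜ π₁ᶜ)) π₂ᶜ))
        (π₂ᶜ ∘ᶜ (π₁ᶜ ∘ᶜ π₁ᶜ))))
      (π₂ᶜ ∘ᶜ π₂ᶜ)))
    (π₂ᶜ ∘ᶜ π₁ᶜ)))
  where
  -- Code 0 is passed on, so a failed stage makes all later ones fail, as in the `Maybe` monad.
  step : ℕ → ℕ → ℕ → ℕ → ℕ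
  step k a i = caseℕ 0 (λ v → codeSym (eval k g (pair a (pair i v))))

  agree : ∀ k a n → natrec (codeSym (eval k f a)) (step k a) n ≡ codeSym (primrec k f g a n)
  agree k a zero = refl
  agree k a (suc n) rewrite agree k a n with primrec k f g a n
  ... | nothing = refl
  ... | just v  = refl

-- A probe of the μ-search at i answers 0 to go on, 1 if the computation at i
-- runs out of fuel, and 2 + i if it finds a zero at i.
probe : ℕ → ℕ → ℕ → ℕ → ℕ
probe k f x i = caseℕ 1 (caseℕ (2 + i) (λ _ → 0)) (codeSym (eval k f (pair x i)))

-- `pred` turns 1 into the code of `nothing` and `2 + i` into that of `just i`; a scan without an
-- answer also gives 0. The start `n` is general for the induction, and the premise says that the
-- search gets as far as `n`.
search-scan : ∀ k j f x n → scan (probe k f x) n ≡ 0 →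
              pred (scan (probe k f x) (j + n)) ≡ codeSym (search k j f x n)
search-scan k zero    f x n eq = cong pred eq
search-scan k (suc j) f x n eq with eval k f (pair x n) in p
... | nothing      = cong pred (trans (cong (scan v) (sym (+-suc j n))) (scan-stable v {suc n} j q))
  where
  v = probe k f x
  q : scan v (suc n) ≡ 1
  q rewrite eq | p = refl
... | just zero    = cong pred (trans (cong (scan v) (sym (+-suc j n))) (scan-stable v {suc n} j q))
  where
  v = probe k f x
  q : scan v (suc n) ≡ 2 + n
  q rewrite eq | p = refl
... | just (suc w) = trans (cong (pred ∘ scan v) (sym (+-suc j n))) (search-scan k j f x (suc n) q)
  where
  v = probe k f x
  q : scan v (suc n) ≡ 0
  q rewrite eq | p = refl

bounded-search : ∀ {f} → BoundedEval f → Computable₂ (λ x k → codeSym (search k k f x 0))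
bounded-search {f} F = curried (computable-cong (λ z → agree (π₂ z) (π₁ z))
  (predᶜ ∘ᶜ scanᶜ {v = λ z → probe (π₂ z) f (π₁ z)}
    (curried (caseᶜ {s = λ w → caseℕ (2 + π₂ w) (λ _ → 0)} (constᶜ 1)
      (curried (caseᶜ {s = λ _ _ → 0} (sucᶜ ∘ᶜ (sucᶜ ∘ᶜ (π₂ᶜ ∘ᶜ π₁ᶜ))) (curried (constᶜ 0)) π₂ᶜ))
      (apply₂ F (pairᶜ (π₁ᶜ ∘ᶜ π₁ᶜ) π₂ᶜ) (π₂ᶜ ∘ᶜ π₁ᶜ))))
    π₂ᶜ))
  where
  agree : ∀ k x → pred (scan (probe k f x) k) ≡ codeSym (search k k f x 0)
  agree k x = trans (cong (pred ∘ scan (probe k f x)) (sym (+-identityʳ k))) (search-scan k k f x 0 refl)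

boundedᶜ : ∀ e → BoundedEval e
boundedᶜ = <-rec BoundedEval build
  where
  build : ∀ e → (∀ {i} → i < e → BoundedEval i) → BoundedEval e
  build e rec with unpair e in p
  ... | 0 , _ = bounded-step {e} (λ k x → just 0) unfold (curried (constᶜ 1))
    where
    unfold : ∀ k x → eval (suc k) e x ≡ just 0
    unfold k x rewrite p = refl
  ... | 1 , _ = bounded-step {e} (λ k x → just (suc x)) unfold (curried (sucᶜ ∘ᶜ (sucᶜ ∘ᶜ π₁ᶜ)))
    where
    unfold : ∀ k x → eval (suc k) e x ≡ just (suc x)
    unfold k x rewrite p = refl
  ... | 2 , _ = bounded-step {e} (λ k x → just (π₁ x)) unfold (curried (sucᶜ ∘ᶜ (π₁ᶜ ∘ᶜ π₁ᶜ)))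
    where
    unfold : ∀ k x → eval (suc k) e x ≡ just (π₁ x)
    unfold k x rewrite p = refl
  ... | 3 , _ = bounded-step {e} (λ k x → just (π₂ x)) unfold (curried (sucᶜ ∘ᶜ (π₂ᶜ ∘ᶜ π₁ᶜ)))
    where
    unfold : ∀ k x → eval (suc k) e x ≡ just (π₂ x)
    unfold k x rewrite p = refl
  ... | 4 , r = bounded-step {e} _ (λ k x → eval-comp k e x p refl)
    (bounded-comp (rec (≤-<-trans (π₁≤ r) (unpair-< e p))) (rec (≤-<-trans (π₂≤ r) (unpair-< e p))))
  ... | 5 , r = bounded-step {e} _ (λ k x → eval-pairing k e x p refl)
    (bounded-pairing (rec (≤-<-trans (π₁≤ r) (unpair-< e p))) (rec (≤-<-trans (π₂≤ r) (unpair-< e p))))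
  ... | 6 , r = bounded-step {e} _ (λ k x → eval-recursor k e x p refl)
    (bounded-primrec (rec (≤-<-trans (π₁≤ r) (unpair-< e p))) (rec (≤-<-trans (π₂≤ r) (unpair-< e p))))
  ... | 7 , f = bounded-step {e} (λ k x → search k k f x 0) unfold (bounded-search (rec (unpair-< e p)))
    where
    unfold : ∀ k x → eval (suc k) e x ≡ search k k f x 0
    unfold k x rewrite p = refl
  ... | suc (suc (suc (suc (suc (suc (suc (suc _))))))) , _ =
    bounded-step {e} (λ k x → just 0) unfold (curried (constᶜ 1))
    where
    unfold : ∀ k x → eval (suc k) e x ≡ just 0
    unfold k x rewrite p = refl

-- Coded sequences

-- The state pairs the code still to be read with the accumulator. An exhausted code leaves the
-- state fixed, so surplus steps are harmless.
foldStep : (ℕ → ℕ → ℕ) → ℕ → ℕ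
foldStep f s = caseℕ s (λ w → pair (π₂ w) (f (π₂ s) (π₁ w))) (π₁ s)

-- The code itself bounds the number of steps.
foldCode : (ℕ → ℕ → ℕ) → ℕ → ℕ → ℕ
foldCode f z c = π₂ (natrec (pair c z) (λ _ → foldStep f) c)

foldCodeᶜ : ∀ f z → Computable₂ f → Computable (foldCode f z)
foldCodeᶜ f z F = π₂ᶜ ∘ᶜ natrecᶜ {s = λ _ _ → foldStep f} (pairᶜ idᶜ (constᶜ z))
  (curried₃ (stepᶜ ∘ᶜ (π₂ᶜ ∘ᶜ π₂ᶜ))) idᶜ
  where
  stepᶜ : Computable (foldStep f)
  stepᶜ = caseᶜ {s = λ s w → pair (π₂ w) (f (π₂ s) (π₁ w))} idᶜ
    (curried (pairᶜ (π₂ᶜ ∘ᶜ π₂ᶜ) (apply₂ F (π₂ᶜ ∘ᶜ π₁ᶜ) (π₁ᶜ ∘ᶜ π₂ᶜ)))) π₁ᶜ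

length≤codeSeq : ∀ σ → length σ ≤ codeSeq σ
length≤codeSeq []      = z≤n
length≤codeSeq (s ∷ σ) = s≤s (≤-trans (length≤codeSeq σ) (b≤pair-a-b (codeSym s) (codeSeq σ)))

foldCode-codeSeq : ∀ f z σ → foldCode f z (codeSeq σ) ≡ foldl f z (map codeSym σ)
foldCode-codeSeq f z σ = trans (cong π₂ (run σ z (codeSeq σ) (length≤codeSeq σ))) (π₂-pair 0 _)
  where
  open ≡-Reasoning

  iter : ℕ → ℕ → ℕ
  iter n s = natrec s (λ _ → foldStep f) n

  -- `natrec` adds its steps on the outside, whereas the list is consumed from its head.
  iter-suc : ∀ n s → iter (suc n) s ≡ iter n (foldStep f s)
  iter-suc zero    s = refl
  iter-suc (suc n) s = cong (foldStep f) (iter-suc n s)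

  step-[] : ∀ z → foldStep f (pair 0 z) ≡ pair 0 z
  step-[] z = cong (caseℕ (pair 0 z) (λ w → pair (π₂ w) (f (π₂ (pair 0 z)) (π₁ w)))) (π₁-pair 0 z)

  step-∷ : ∀ s c z → foldStep f (pair (suc (pair s c)) z) ≡ pair c (f z s)
  step-∷ s c z = begin
    foldStep f (pair (suc (pair s c)) z)
      ≡⟨ cong (caseℕ (pair (suc (pair s c)) z) (λ w → pair (π₂ w) (f (π₂ (pair (suc (pair s c)) z)) (π₁ w)))) (π₁-pair (suc (pair s c)) z) ⟩
    pair (π₂ (pair s c)) (f (π₂ (pair (suc (pair s c)) z)) (π₁ (pair s c)))
      ≡⟨ cong₂ pair (π₂-pair s c) (cong₂ f (π₂-pair (suc (pair s c)) z) (π₁-pair s c)) ⟩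
    pair c (f z s) ∎

  run : ∀ σ z n → length σ ≤ n → iter n (pair (codeSeq σ) z) ≡ pair 0 (foldl f z (map codeSym σ))
  run []      z zero    _ = refl
  run []      z (suc n) _ = trans (cong (foldStep f) (run [] z n z≤n)) (step-[] z)
  run (s ∷ σ) z (suc n) (s≤s l) = begin
    iter (suc n) (pair (codeSeq (s ∷ σ)) z)
      ≡⟨ iter-suc n (pair (codeSeq (s ∷ σ)) z) ⟩
    iter n (foldStep f (pair (codeSeq (s ∷ σ)) z))
      ≡⟨ cong (iter n) (step-∷ (codeSym s) (codeSeq σ) z) ⟩
    iter n (pair (codeSeq σ) (f z (codeSym s)))
      ≡⟨ run σ _ n l ⟩
    pair 0 (foldl f z (map codeSym (s ∷ σ))) ∎

lengthCode : ℕ → ℕ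
lengthCode = foldCode (λ n _ → suc n) 0

lengthCodeᶜ : Computable lengthCode
lengthCodeᶜ = foldCodeᶜ (λ n _ → suc n) 0 (curried (sucᶜ ∘ᶜ π₁ᶜ))

lengthCode-codeSeq : ∀ σ → lengthCode (codeSeq σ) ≡ length σ
lengthCode-codeSeq σ = trans (foldCode-codeSeq (λ n _ → suc n) 0 σ) (count 0 σ)
  where
  count : ∀ n σ → foldl (λ n _ → suc n) n (map codeSym σ) ≡ n + length σ
  count n []      = sym (+-identityʳ n)
  count n (s ∷ σ) = trans (count (suc n) σ) (sym (+-suc n (length σ)))

reverseCode : ℕ → ℕ
reverseCode = foldCode (λ c s → suc (pair s c)) 0

reverseCodeᶜ : Computable reverseCode
reverseCodeᶜ = foldCodeᶜ (λ c s → suc (pair s c)) 0 (curried (sucᶜ ∘ᶜ pairᶜ π₂ᶜ π₁ᶜ))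

reverseCode-codeSeq : ∀ σ → reverseCode (codeSeq σ) ≡ codeSeq (reverse σ)
reverseCode-codeSeq σ = trans (foldCode-codeSeq (λ c s → suc (pair s c)) 0 σ) (shift [] σ)
  where
  shift : ∀ τ σ → foldl (λ c s → suc (pair s c)) (codeSeq τ) (map codeSym σ) ≡
                  codeSeq (foldl (flip _∷_) τ σ)
  shift τ []      = refl
  shift τ (s ∷ σ) = shift (s ∷ τ) σ

-- The tail of the empty code is again empty, as `pred 0` and `π₂ 0` are 0; dropping too many
-- symbols is harmless.
tailCode : ℕ → ℕ
tailCode c = π₂ (pred c)

dropCode : ℕ → ℕ → ℕ
dropCode i c = natrec c (λ _ → tailCode) i

dropCodeᶜ : Computable₂ dropCode
dropCodeᶜ = curried (natrecᶜ {s = λ _ _ → tailCode} π₂ᶜ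
  (curried₃ (π₂ᶜ ∘ᶜ (predᶜ ∘ᶜ (π₂ᶜ ∘ᶜ π₂ᶜ)))) π₁ᶜ)

nthCode : ℕ → ℕ → ℕ
nthCode i c = π₁ (pred (dropCode i c))

nthCodeᶜ : Computable₂ nthCode
nthCodeᶜ = curried (π₁ᶜ ∘ᶜ (predᶜ ∘ᶜ uncurried dropCodeᶜ))

dropCode-++ : ∀ σ τ → dropCode (length σ) (codeSeq (σ ++ τ)) ≡ codeSeq τ
dropCode-++ []      τ = refl
dropCode-++ (s ∷ σ) τ = trans (drop-suc (length σ) _)
  (trans (cong (dropCode (length σ)) (π₂-pair (codeSym s) _)) (dropCode-++ σ τ))
  where
  drop-suc : ∀ i c → dropCode (suc i) c ≡ dropCode i (tailCode c)
  drop-suc zero    c = refl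
  drop-suc (suc i) c = cong tailCode (drop-suc i c)

length-prefix : ∀ T n → length (prefix T n) ≡ n
length-prefix T zero    = refl
length-prefix T (suc n) = trans (length-++ (prefix T n))
  (trans (+-comm _ 1) (cong suc (length-prefix T n)))

-- Prefixes grow at the right end but codes are read from the left; the split puts `T i` at the head
-- once `i` symbols are dropped.
prefix-split : ∀ T i k → ∃[ τ ] prefix T (k + suc i) ≡ prefix T i ++ T i ∷ τ
prefix-split T i zero    = [] , refl
prefix-split T i (suc k) with prefix-split T i k
... | τ , eq = τ ∷ʳ T (k + suc i) ,
  trans (cong (_∷ʳ T (k + suc i)) eq) (++-assoc (prefix T i) (T i ∷ τ) _)

nthCode-prefix : ∀ T {i n} → i < n → nthCode i (codeSeq (prefix T n)) ≡ codeSym (T i)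
nthCode-prefix T {i} {n} i<n with prefix-split T i (n ∸ suc i)
... | τ , eq = begin
  nthCode i (codeSeq (prefix T n))
    ≡⟨ cong (nthCode i ∘ codeSeq) (trans (cong (prefix T) (sym (m∸n+n≡m i<n))) eq) ⟩
  nthCode i (codeSeq (prefix T i ++ T i ∷ τ))
    ≡⟨ cong (λ j → nthCode j (codeSeq (prefix T i ++ T i ∷ τ))) (sym (length-prefix T i)) ⟩
  nthCode (length (prefix T i)) (codeSeq (prefix T i ++ T i ∷ τ))
    ≡⟨ cong (π₁ ∘ pred) (dropCode-++ (prefix T i) (T i ∷ τ)) ⟩
  π₁ (pair (codeSym (T i)) (codeSeq τ))
    ≡⟨ π₁-pair (codeSym (T i)) (codeSeq τ) ⟩
  codeSym (T i) ∎
  where open ≡-Reasoning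

-- Full-information learners simulate iterative ones

-- `w` codes the argument of a recursion step: the whole prefix, the counter `i` and hypothesis
-- number `i`. `nthCode` yields the datum already coded by `codeSym`.
iterationInput : ℕ → ℕ
iterationInput w = suc (pair (π₂ (π₂ w)) (nthCode (π₁ (π₂ w)) (π₁ w)))

iterationInputᶜ : Computable iterationInput
iterationInputᶜ = sucᶜ ∘ᶜ pairᶜ (π₂ᶜ ∘ᶜ π₂ᶜ) (apply₂ nthCodeᶜ (π₁ᶜ ∘ᶜ π₂ᶜ) π₁ᶜ)

iterationLoop : ℕ → ℕ
iterationLoop h = recursor (comp h (constᶜ 0 .index)) (comp h (iterationInputᶜ .index))

unroll : ℕ → ℕ
unroll h = comp (iterationLoop h) (pairing (idᶜ .index) (lengthCodeᶜ .index))

-- Partiality of `h` does no harm: a derivation of `It` contains the convergence of all earlier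
-- hypotheses, and these are the stages of the recursion.
It⇒G : ∀ h T {n p} → It h T n p → G (unroll h) T n p
It⇒G h T {n} {p} it = ↓-comp (↓-pairing (idᶜ .computes c) (lengthCodeᶜ .computes c))
  (subst (λ m → iterationLoop h · pair c m ↓ p)
    (sym (trans (lengthCode-codeSeq (prefix T n)) (length-prefix T n))) (loop ≤-refl it))
  where
  c = codeSeq (prefix T n)

  input : ∀ {i} q → i < n → iterationInput (pair c (pair i q)) ≡ codeItStep q (T i)
  input {i} q i<n rewrite unpair-pair c (pair i q) | unpair-pair i q =
    cong (suc ∘ pair q) (nthCode-prefix T i<n)

  -- The bound `i ≤ n` keeps every lookup inside the prefix.
  loop : ∀ {i q} → i ≤ n → It h T i q → iterationLoop h · pair c i ↓ q
  loop _ (it-zero start) =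
    ↓-recursor-zero {g = comp h (iterationInputᶜ .index)} {c} (↓-comp (constᶜ 0 .computes c) start)
  loop i<n (it-suc {i} {p} {q} it step) =
    ↓-recursor-suc {f = comp h (constᶜ 0 .index)} {a = c} {i} (loop (<⇒≤ i<n) it)
      (↓-comp (subst (iterationInputᶜ .index · pair c (pair i p) ↓_) (input p i<n)
                 (iterationInputᶜ .computes (pair c (pair i p)))) step)

-- Padding

-- On `pad e s` the five projections strip in turn the tag of `comp`, the index of `π₁`, the tag of
-- `pairing`, the index `e` and the tag of the zero function.
unpad : ℕ → ℕ
unpad p = π₂ (π₂ (π₂ (π₂ (π₂ p))))

unpadᶜ : Computable unpad
unpadᶜ = π₂ᶜ ∘ᶜ (π₂ᶜ ∘ᶜ (π₂ᶜ ∘ᶜ (π₂ᶜ ∘ᶜ π₂ᶜ)))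

compᶜ : ∀ {f g} → Computable f → Computable g → Computable (λ x → comp (f x) (g x))
compᶜ {f} {g} F G = computable-cong (λ x → comp-pair (f x) (g x)) (pairᶜ (constᶜ 4) (pairᶜ F G))

pairingᶜ : ∀ {f g} → Computable f → Computable g → Computable (λ x → pairing (f x) (g x))
pairingᶜ {f} {g} F G = computable-cong (λ x → pairing-pair (f x) (g x)) (pairᶜ (constᶜ 5) (pairᶜ F G))

eval-zero : ∀ k z x {r} → unpair z ≡ (0 , r) → eval (suc k) z x ≡ just 0
eval-zero k z x eq rewrite eq = refl

opaque
  -- Index of π₁ ∘ ⟨e, 0⟩, where s rides along as the unused part of an index of the zero function.
  pad : ℕ → ℕ → ℕ
  pad e s = comp (π₁ᶜ .index) (pairing e (pair 0 s))

  padᶜ : Computable₂ pad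
  padᶜ = curried (compᶜ (constᶜ (π₁ᶜ .index)) (pairingᶜ π₁ᶜ (pairᶜ (constᶜ 0) π₂ᶜ)))

  unpad-pad : ∀ e s → unpad (pad e s) ≡ s
  unpad-pad e s = begin
    unpad (pad e s)
      ≡⟨ cong (π₂ ∘ π₂ ∘ π₂ ∘ π₂ ∘ proj₂) (unpair-comp (π₁ᶜ .index) q) ⟩
    π₂ (π₂ (π₂ (π₂ (pair (π₁ᶜ .index) q))))
      ≡⟨ cong (π₂ ∘ π₂ ∘ π₂) (π₂-pair (π₁ᶜ .index) q) ⟩
    π₂ (π₂ (π₂ q))
      ≡⟨ cong (π₂ ∘ π₂ ∘ proj₂) (unpair-pairing e (pair 0 s)) ⟩
    π₂ (π₂ (pair e (pair 0 s)))
      ≡⟨ cong π₂ (π₂-pair e (pair 0 s)) ⟩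
    π₂ (pair 0 s)
      ≡⟨ π₂-pair 0 s ⟩
    s ∎
    where
    open ≡-Reasoning
    q : ℕ
    q = pairing e (pair 0 s)

  ↓-pad : ∀ {e s x y} → e · x ↓ y → pad e s · x ↓ y
  ↓-pad {e} {s} {x} {y} p = ↓-comp {u = pair y 0}
    (↓-pairing {e} {pair 0 s} p (1 , eval-zero 0 (pair 0 s) x (unpair-pair 0 s)))
    (subst (π₁ᶜ .index · pair y 0 ↓_) (π₁-pair y 0) (π₁ᶜ .computes (pair y 0)))

pad-IsCIndex : ∀ {e} s → IsCIndex e → IsCIndex (pad e s)
pad-IsCIndex s total x with total x
... | y , p , bit = y , ↓-pad {s = s} p , bit

-- `↓-pad` leads only from `e` to the padded index. For the converse, totality gives a value of `e`,
-- and uniqueness of values identifies it with 1.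
C-pad : ∀ {e} s → IsCIndex e → ∀ x → C (pad e s) x ⇔ C e x
C-pad {e} s total x = mk⇔ to (↓-pad {s = s})
  where
  to : C (pad e s) x → C e x
  to p with total x
  ... | y , q , _ = subst (e · x ↓_) (↓-functional (↓-pad {s = s} q) p) q

-- Iterative learners simulate full-information ones

-- Newest symbol first, so that recording a datum is a single cons and dropping `t` symbols forgets
-- the latest `t`.
history : Text → ℕ → ℕ
history T n = codeSeq (reverse (prefix T n))

history-suc : ∀ T n → history T (suc n) ≡ suc (pair (codeSym (T n)) (history T n))
history-suc T n = cong codeSeq (reverse-++ (prefix T n) (T n ∷ []))

n≤history : ∀ T n → n ≤ history T n
n≤history T zero    = z≤n
n≤history T (suc n) rewrite history-suc T n =
  s≤s (≤-trans (n≤history T n) (b≤pair-a-b (codeSym (T n)) (history T n)))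

dropCode-history : ∀ T n t → dropCode t (history T n) ≡ history T (n ∸ t)
dropCode-history T n zero    = refl
dropCode-history T n (suc t) = begin
  tailCode (dropCode t (history T n))  ≡⟨ cong tailCode (dropCode-history T n t) ⟩
  tailCode (history T (n ∸ t))         ≡⟨ tail-history (n ∸ t) ⟩
  history T (pred (n ∸ t))             ≡⟨ cong (history T) (pred[m∸n]≡m∸[1+n] n t) ⟩
  history T (n ∸ suc t)                ∎
  where
  open ≡-Reasoning
  tail-history : ∀ m → tailCode (history T m) ≡ history T (pred m)
  tail-history zero    = refl
  tail-history (suc m) = trans (cong tailCode (history-suc T m)) (π₂-pair (codeSym (T m)) _)

reverseCode-history : ∀ T n → reverseCode (history T n) ≡ codeSeq (prefix T n)
reverseCode-history T n = trans (reverseCode-codeSeq (reverse (prefix T n)))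
  (cong codeSeq (reverse-involutive (prefix T n)))

-- The history also serves as the step bound: it grows along every text.
trial : ℕ → ℕ → ℕ → ℕ
trial h d t = codeSym (eval d h (reverseCode (dropCode t d)))

-- Trial `t` forgets `t` symbols, so the first hit is the longest prefix seen to halt. Trials up to
-- `d` reach every prefix because a history is at least as large as its length. If nothing halts,
-- the guess defaults to 0.
bestGuess : ℕ → ℕ → ℕ
bestGuess h d = pred (scan (trial h d) (suc d))

bestGuessᶜ : ∀ h → Computable (bestGuess h)
bestGuessᶜ h = predᶜ ∘ᶜ scanᶜ {v = trial h}
  (curried (apply₂ (boundedᶜ h) (reverseCodeᶜ ∘ᶜ apply₂ dropCodeᶜ π₂ᶜ π₁ᶜ) π₁ᶜ)) sucᶜ

codeSym-suc : ∀ m {y} → codeSym m ≡ suc y → m ≡ just y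
codeSym-suc (just y) refl = refl

-- Trial `n ∸ n₀` runs `h` on the prefix of length `n₀` with fuel at least `k` and halts, so the
-- scan stops there or earlier, on a prefix at least as long.
bestGuess-history : ∀ h T {n₀ n k y} → n₀ ≤ n → k ≤ n →
  eval k h (codeSeq (prefix T n₀)) ≡ just y →
  ∃[ m ] (n₀ ≤ m × G h T m (bestGuess h (history T n)))
bestGuess-history h T {n₀} {n} {k} {y} n₀≤n k≤n halts
  with scan-complete (trial h (history T n))
         (s≤s (≤-trans (m∸n≤m n n₀) (n≤history T n)))
         (trans (trial-history (n ∸ n₀))
           (cong codeSym (trans (cong (eval (history T n) h ∘ codeSeq ∘ prefix T) (m∸[m∸n]≡n n₀≤n))
             (eval-mono {e = h} {codeSeq (prefix T n₀)} (≤-trans k≤n (n≤history T n)) halts))))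
  where
  trial-history : ∀ t → trial h (history T n) t ≡ codeSym (eval (history T n) h (codeSeq (prefix T (n ∸ t))))
  trial-history t = cong (codeSym ∘ eval (history T n) h)
    (trans (cong reverseCode (dropCode-history T n t)) (reverseCode-history T (n ∸ t)))
... | t , w , t≤ , hit , found = n ∸ t ,
  ≤-trans (≤-reflexive (sym (m∸[m∸n]≡n n₀≤n))) (∸-monoʳ-≤ n t≤) ,
  history T n ,
  trans (codeSym-suc _ (trans (cong (codeSym ∘ eval (history T n) h)
          (sym (trans (cong reverseCode (dropCode-history T n t)) (reverseCode-history T (n ∸ t))))) hit))
        (cong (just ∘ pred) (sym found))

hypothesis : ℕ → ℕ → ℕ
hypothesis h d = pad (bestGuess h d) d

-- Input 0 is the start, with empty history; any other input carries the old history inside the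
-- padded hypothesis, and a datum that is already coded.
nextHistory : ℕ → ℕ
nextHistory = caseℕ 0 (λ w → suc (pair (π₂ w) (unpad (π₁ w))))

iterativeᶜ : ∀ h → Computable (λ z → hypothesis h (nextHistory z))
iterativeᶜ h = apply₂ padᶜ (bestGuessᶜ h) idᶜ ∘ᶜ
  caseᶜ {s = λ _ w → suc (pair (π₂ w) (unpad (π₁ w)))} (constᶜ 0)
    (curried (sucᶜ ∘ᶜ pairᶜ (π₂ᶜ ∘ᶜ π₂ᶜ) (unpadᶜ ∘ᶜ (π₁ᶜ ∘ᶜ π₂ᶜ)))) idᶜ

-- The iterative learner is total, so the history survives stages at which `h` diverges.
iterative-history : ∀ h T n → It (iterativeᶜ h .index) T n (hypothesis h (history T n))
iterative-history h T zero    = it-zero (iterativeᶜ h .computes codeItStart)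
iterative-history h T (suc n) = it-suc (iterative-history h T n)
  (subst (iterativeᶜ h .index · codeItStep p (T n) ↓_) (cong (hypothesis h) next)
    (iterativeᶜ h .computes (codeItStep p (T n))))
  where
  open ≡-Reasoning
  p = hypothesis h (history T n)
  next : nextHistory (codeItStep p (T n)) ≡ history T (suc n)
  next = begin
    suc (pair (π₂ (pair p (codeSym (T n)))) (unpad (π₁ (pair p (codeSym (T n))))))
      ≡⟨ cong suc (cong₂ pair (π₂-pair p _)
           (trans (cong unpad (π₁-pair p (codeSym (T n)))) (unpad-pad _ (history T n)))) ⟩
    suc (pair (codeSym (T n)) (history T n))
      ≡⟨ history-suc T n ⟨
    history T (suc n) ∎

G⇒It : ∀ h T → BcC (G h T) T → BcC (It (iterativeᶜ h .index) T) T
G⇒It h T (n₀ , good) with good n₀ ≤-refl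
-- From `n₀` on all hypotheses of `h` are correct; from `k` on the step bound suffices to see `h`
-- halt on the prefix of length `n₀`.
... | _ , (k , halts) , _ = n₀ ⊔ k , correct
  where
  correct : ∀ n → n₀ ⊔ k ≤ n → ∃[ e ] (It (iterativeᶜ h .index) T n e × IsCIndex e ×
                                       (∀ x → C e x ⇔ content T x))
  correct n bound with bestGuess-history h T (≤-trans (m≤m⊔n n₀ k) bound) (≤-trans (m≤n⊔m n₀ k) bound) halts
  -- The guess may change with `n`, but each one is the hypothesis of `h` at some stage `m ≥ n₀`,
  -- hence correct.
  ... | m , n₀≤m , guess with good m n₀≤m
  ...   | e , hyp , total , same with ↓-functional hyp guess
  ...     | refl = pad e d , iterative-history h T n , pad-IsCIndex d total ,
    λ x → same x ⇔-∘ C-pad d total x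
    where d = history T n

theorem16 : (ℒ : Lang → Set) → LearnableREC It ℒ ⇔ LearnableREC G ℒ
theorem16 ℒ = mk⇔
  -- The hypotheses coincide stage by stage, so `n₀` and the indices carry over.
  (λ (rec , h , learns) → rec , unroll h , λ L L∈ℒ T text →
    map₂ (λ good n n₀≤n → map₂ (λ (it , correct) → It⇒G h T it , correct) (good n n₀≤n))
         (learns L L∈ℒ T text))
  (λ (rec , h , learns) → rec , iterativeᶜ h .index , λ L L∈ℒ T text → G⇒It h T (learns L L∈ℒ T text))
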